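{- Let $G=(V,E)$ be a locally finite, connected, simple, unweighted $C_4$-free graph with minimum degree $\delta(G)\ge 2$, equipped with the normalized Laplacian $\Delta f(x)=\frac{1}{d_x}\sum_{y\sim x}(f(y)-f(x))$. If $G$ satisfies $CD(0,\infty)$ and contains at least one triangle, then $G\cong F_k$ for some $1\le k\le 7$.
   Context: $G$ is $C_4$-free if it contains no $4$-cycle as a subgraph; $d_x$ is the degree of $x$. For $f,g:V\to\mathbb R$ define $2\Gamma(f,g)=\Delta(fg)-f\Delta g-g\Delta f$ and $2\Gamma_2(f,g)=\Delta\Gamma(f,g)-\Gamma(f,\Delta g)-\Gamma(\Delta f,g)$, $\Gamma_2(f)=\Gamma_2(f,f)$. $G$ satisfies $CD(0,\infty)$ if $\Gamma_2(f)(x)\ge0$ for all $f:V\to\mathbb R$ and all $x\in V$. The friendship graph $F_k$ is obtained from $k$ triangles by identifying one vertex of each into a single common vertex. -}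

module Defs where

open import Data.Nat as ℕ using (ℕ; zero; suc)
open import Data.Integer using (+_)
open import Data.Rational using (ℚ; 0ℚ; _+_; _-_; _*_; _/_; _≤_)
open import Data.List using (List; foldr; map; length)
open import Data.List.Membership.Propositional using (_∈_)
open import Data.List.Relation.Unary.Unique.Propositional using (Unique)
open import Data.Fin using (Fin)
open import Data.Bool using (Bool)
open import Data.Unit using (⊤; tt)
open import Data.Sum using (_⊎_; inj₁; inj₂)
open import Data.Product using (Σ; ∃; _×_; _,_)
open import Data.Empty using (⊥)
open import Relation.Nullary using (¬_)
open import Relation.Binary.PropositionalEquality using (_≡_; _≢_)
open import Relation.Binary.Construct.Closure.ReflexiveTransitive using (Star)
open import Function.Bundles using (_↔_; Inverse; _⇔_)

-- A simple, unweighted, locally finite graph on a (possibly infinite) vertex type V.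
-- The neighbourhood of each vertex is given as a finite duplicate-free list;
-- adjacency  x ∼ y  is defined as  y ∈ nbrs x.
record Graph : Set₁ where
  field
    V       : Set
    nbrs    : V → List V
    unique  : ∀ x → Unique (nbrs x)
    sym     : ∀ {x y} → y ∈ nbrs x → x ∈ nbrs y
    irrefl  : ∀ x → ¬ (x ∈ nbrs x)

module _ (G : Graph) where
  open Graph G

  Adj : V → V → Set
  Adj x y = y ∈ nbrs x

  deg : V → ℕ
  deg x = length (nbrs x)

  Connected : Set
  Connected = ∀ x y → Star Adj x y

  MinDegree≥2 : Set
  MinDegree≥2 = ∀ x → 2 ℕ.≤ deg x

  C4Free : Set
  C4Free = ∀ a b c d → a ≢ b → a ≢ c → a ≢ d → b ≢ c → b ≢ d → c ≢ d →
           Adj a b → Adj b c → Adj c d → Adj d a → ⊥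

  HasTriangle : Set
  HasTriangle = Σ V λ a → Σ V λ b → Σ V λ c → Adj a b × Adj b c × Adj c a

  sumℚ : List ℚ → ℚ
  sumℚ = foldr _+_ 0ℚ

  -- 1 / n  (with 1/0 := 0, never used under δ(G) ≥ 2)
  inv : ℕ → ℚ
  inv zero    = 0ℚ
  inv (suc n) = (+ 1) / suc n

  ½ : ℚ
  ½ = (+ 1) / 2

  Δ : (V → ℚ) → V → ℚ
  Δ f x = inv (deg x) * sumℚ (map (λ y → f y - f x) (nbrs x))

  Γ : (V → ℚ) → (V → ℚ) → V → ℚ
  Γ f g x = ½ * ((Δ (λ z → f z * g z) x - f x * Δ g x) - g x * Δ f x)

  Γ₂ : (V → ℚ) → (V → ℚ) → V → ℚ
  Γ₂ f g x = ½ * ((Δ (Γ f g) x - Γ f (Δ g) x) - Γ (Δ f) g x)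

  CD0∞ : Set
  CD0∞ = ∀ (f : V → ℚ) (x : V) → 0ℚ ≤ Γ₂ f f x

-- Friendship graph F_k: centre inj₁ tt, and for each i : Fin k a triangle
-- on the centre and the two vertices inj₂ (i , false), inj₂ (i , true).
FV : ℕ → Set
FV k = ⊤ ⊎ (Fin k × Bool)

FAdj : (k : ℕ) → FV k → FV k → Set
FAdj k (inj₁ _)       (inj₁ _)       = ⊥
FAdj k (inj₁ _)       (inj₂ _)       = ⊤
FAdj k (inj₂ _)       (inj₁ _)       = ⊤
FAdj k (inj₂ (i , b)) (inj₂ (j , c)) = (i ≡ j) × (b ≢ c)

_≅F_ : Graph → ℕ → Set
G ≅F k = Σ (Graph.V G ↔ FV k) λ φ →
           ∀ x y → Adj G x y ⇔ FAdj k (Inverse.to φ x) (Inverse.to φ y)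

{-# OPTIONS --safe #-}

-- If f(x) = 0 then 4 d_x Γ₂(f)(x) = Σ_{y∼x} [ (1/d_y) Σ_{z∼y} (f(z) - 2f(y))² - 2f(y)² ] + (2/d_x) (Σ_{y∼x} f(y))².
-- In a C₄-free graph every vertex of the second sphere of x has a unique neighbour y ∼ x, so f
-- may be extended there by 2f(y); the curvature condition then becomes a quadratic form on the
-- neighbours of x, coupling only those which span a triangle with x.
-- Four test functions finish the proof: two of them show that an edge at a vertex of a triangle
-- lies in a triangle, hence (by connectedness) every edge does; the third that a vertex of degree
-- at least 4 has no neighbour of degree at least 4, so that some vertex is adjacent to all others;
-- the fourth that this centre has degree less than 16.
module Submission where

open import Defs
open import Data.Bool using (true; false)
open import Data.Empty using (⊥-elim)
open import Data.Fin using (zero; suc; toℕ)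
open import Data.Fin.Properties using (toℕ-injective)
import Data.Integer as ℤ
import Data.Integer.Properties as ℤ
open import Data.List using (List; []; _∷_; _++_; map; length; lookup; foldr)
open import Data.List.Membership.Propositional using (_∈_; _∉_; find; lose)
open import Data.List.Membership.Propositional.Properties
  using (∈-∃++; ∈-++⁺ʳ; ∈-++⁻; ∈-map⁺; ∈-map⁻; ∈-lookup; ∈-length)
import Data.List.Membership.DecPropositional as DecMembership
open import Data.List.Properties using (length-++; length-map; ∷-injective; ≡-dec)
open import Data.List.Relation.Binary.Permutation.Propositional using (_↭_; prep; ↭-refl; ↭-trans; ↭-sym; ↭⇒↭ₛ)
open import Data.List.Relation.Binary.Permutation.Propositional.Properties using (∈-resp-↭; ↭-length; shift; map⁺)
import Data.List.Relation.Binary.Permutation.Setoid.Properties as PermSetoid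
open import Data.List.Relation.Binary.Subset.Propositional using (_⊆_)
open import Data.List.Relation.Unary.All as All using ([]; _∷_)
open import Data.List.Relation.Unary.All.Properties using (¬Any⇒All¬)
open import Data.List.Relation.Unary.AllPairs using ([]; _∷_)
open import Data.List.Relation.Unary.Any using (here; there; any?; index)
open import Data.List.Relation.Unary.Any.Properties using (lookup-index)
open import Data.List.Relation.Unary.Unique.Propositional using (Unique)
import Data.List.Relation.Unary.Unique.Propositional.Properties as Unique
open import Data.Nat as ℕ using (ℕ; suc; _≤_)
import Data.Nat.Properties as ℕ
open import Data.Product using (Σ; ∃; _×_; _,_; proj₁; proj₂)
open import Data.Rational as ℚ using (ℚ; 0ℚ; 1ℚ; _+_; _-_; _*_; _/_)
import Data.Rational.Properties as ℚ
open import Data.Rational.Solver using (module +-*-Solver)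
import Data.Rational.Unnormalised as ℚᵘ
import Data.Rational.Unnormalised.Properties as ℚᵘ
open import Data.Sum using (_⊎_; inj₁; inj₂)
open import Data.Unit using (tt)
open import Function using (_∘_; case_of_)
open import Function.Bundles using (mk⇔; mk↔ₛ′)
open import Relation.Binary using (DecidableEquality)
open import Relation.Binary.Construct.Closure.ReflexiveTransitive using (Star; ε; _◅_)
open import Relation.Binary.PropositionalEquality
open import Relation.Nullary using (¬_; yes; no; contradiction)
open import Relation.Nullary.Decidable using (from-no; map′; ¬?; decidable-stable)

open +-*-Solver using (Polynomial; solve; con; _:+_; _:*_; _:-_; _:=_)

private variable
  A : Set

-- Duplicate-free lists and their sublists.

extract : ∀ {x : A} {xs} → x ∈ xs → ∃ λ ys → xs ↭ x ∷ ys
extract x∈xs with ∈-∃++ x∈xs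
... | ys , zs , refl = ys ++ zs , shift _ ys zs

-- Splits a neighbourhood into the support of a summand and the rest; it also yields the cardinality
-- bounds used to count neighbours.
split-off : ∀ {ks xs : List A} → Unique ks → Unique xs → ks ⊆ xs →
            ∃ λ rs → (xs ↭ ks ++ rs) × (∀ {z} → z ∈ rs → z ∉ ks)
split-off {ks = []} {xs} _ _ _ = xs , ↭-refl , λ _ ()
split-off {ks = k ∷ ks} {xs} (k# ∷ uks) uxs ks⊆xs with extract (ks⊆xs (here refl))
... | ys , xs↭kys with PermSetoid.Unique-resp-↭ (setoid _) (↭⇒↭ₛ xs↭kys) uxs
... | uk∷ys@(_ ∷ uys) with split-off uks uys ks⊆ys
  where
  ks⊆ys : ks ⊆ ys
  ks⊆ys z∈ks with ∈-resp-↭ xs↭kys (ks⊆xs (there z∈ks))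
  ... | here z≡k   = contradiction (sym z≡k) (All.lookup k# z∈ks)
  ... | there z∈ys = z∈ys
... | rs , ys↭ , rs# = rs , ↭-trans xs↭kys (prep k ys↭) , disjoint
  where
  disjoint : ∀ {z} → z ∈ rs → z ∉ k ∷ ks
  disjoint z∈rs (here refl)  = Unique.Unique[x∷xs]⇒x∉xs uk∷ys (∈-resp-↭ (↭-sym ys↭) (∈-++⁺ʳ ks z∈rs))
  disjoint z∈rs (there z∈ks) = rs# z∈rs z∈ks

⊆⇒length≤ : ∀ {ks xs : List A} → Unique ks → Unique xs → ks ⊆ xs → length ks ≤ length xs
⊆⇒length≤ {ks = ks} uks uxs ks⊆xs with split-off uks uxs ks⊆xs
... | rs , xs↭ , _ rewrite ↭-length xs↭ | length-++ ks {rs} = ℕ.m≤m+n _ _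

-- Finite sums of rationals.

# : ℕ → ℚ
# n = ℤ.+ n / 1

∑ : List A → (A → ℚ) → ℚ
∑ xs h = foldr _+_ 0ℚ (map h xs)

∑-cong : ∀ {h k : A → ℚ} xs → (∀ {z} → z ∈ xs → h z ≡ k z) → ∑ xs h ≡ ∑ xs k
∑-cong []       eq = refl
∑-cong (x ∷ xs) eq = cong₂ _+_ (eq (here refl)) (∑-cong xs (eq ∘ there))

∑-zero : ∀ {h : A → ℚ} xs → (∀ {z} → z ∈ xs → h z ≡ 0ℚ) → ∑ xs h ≡ 0ℚ
∑-zero []       eq = refl
∑-zero (x ∷ xs) eq = trans (cong₂ _+_ (eq (here refl)) (∑-zero xs (eq ∘ there))) refl

∑-++ : ∀ (h : A → ℚ) xs ys → ∑ (xs ++ ys) h ≡ ∑ xs h + ∑ ys h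
∑-++ h []       ys = sym (ℚ.+-identityˡ _)
∑-++ h (x ∷ xs) ys = trans (cong (h x +_) (∑-++ h xs ys)) (sym (ℚ.+-assoc (h x) _ _))

∑-↭ : ∀ (h : A → ℚ) {xs ys} → xs ↭ ys → ∑ xs h ≡ ∑ ys h
∑-↭ h p = PermSetoid.foldr-commMonoid (setoid ℚ) ℚ.+-0-isCommutativeMonoid (↭⇒↭ₛ (map⁺ h p))

∑-support : ∀ (h : A → ℚ) {ks xs} → Unique ks → Unique xs → ks ⊆ xs →
            (∀ {z} → z ∈ xs → z ∉ ks → h z ≡ 0ℚ) → ∑ xs h ≡ ∑ ks h
∑-support h {ks} uks uxs ks⊆xs vanish with split-off uks uxs ks⊆xs
... | rs , xs↭ , rs# =
  trans (∑-↭ h xs↭) (trans (∑-++ h ks rs) (trans (cong (∑ ks h +_)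
    (∑-zero rs λ z∈ → vanish (∈-resp-↭ (↭-sym xs↭) (∈-++⁺ʳ ks z∈)) (rs# z∈))) (ℚ.+-identityʳ _)))

-- Arithmetic of naturals and unit fractions in `ℚ`.

-- Normalisation to lowest terms does not compute for a variable `n`, so identities between such
-- fractions are checked on unnormalised representatives.
toℚᵘ-/ : ∀ i n → ℚ.toℚᵘ (i / suc n) ℚᵘ.≃ ℚᵘ.mkℚᵘ i n
toℚᵘ-/ i n = ℚ.toℚᵘ-fromℚᵘ (ℚᵘ.mkℚᵘ i n)

1+# : ∀ n → 1ℚ + # n ≡ # (suc n)
1+# n = ℚ.toℚᵘ-injective (begin
  ℚ.toℚᵘ (1ℚ + # n)                ≈⟨ ℚ.toℚᵘ-homo-+ 1ℚ (# n) ⟩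
  ℚᵘ.1ℚᵘ ℚᵘ.+ ℚ.toℚᵘ (# n)         ≈⟨ ℚᵘ.+-congʳ ℚᵘ.1ℚᵘ (toℚᵘ-/ (ℤ.+ n) 0) ⟩
  ℚᵘ.1ℚᵘ ℚᵘ.+ ℚᵘ.mkℚᵘ (ℤ.+ n) 0      ≈⟨ ℚᵘ.*≡* (cong (ℤ._* ℤ.+ 1) (cong (λ i → ℤ.+ 1 ℤ.+ i) (ℤ.*-identityʳ (ℤ.+ n)))) ⟩
  ℚᵘ.mkℚᵘ (ℤ.+ suc n) 0              ≈⟨ toℚᵘ-/ (ℤ.+ suc n) 0 ⟨
  ℚ.toℚᵘ (# (suc n))               ∎)
  where open ℚᵘ.≃-Reasoning

∑-const : ∀ c (xs : List A) → ∑ xs (λ _ → c) ≡ # (length xs) * c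
∑-const c []       = sym (ℚ.*-zeroˡ c)
∑-const c (x ∷ xs) = trans (cong (c +_) (∑-const c xs)) (trans
  (solve 2 (λ c n → c :+ n :* c := (con 1ℚ :+ n) :* c) refl c (# (length xs))) (cong (_* c) (1+# (length xs))))

1/n*n≡1 : ∀ n → (ℤ.+ 1 / suc n) * # (suc n) ≡ 1ℚ
1/n*n≡1 n = ℚ.toℚᵘ-injective (begin
  ℚ.toℚᵘ ((ℤ.+ 1 / suc n) * # (suc n))           ≈⟨ ℚ.toℚᵘ-homo-* (ℤ.+ 1 / suc n) (# (suc n)) ⟩
  ℚ.toℚᵘ (ℤ.+ 1 / suc n) ℚᵘ.* ℚ.toℚᵘ (# (suc n)) ≈⟨ ℚᵘ.*-cong (toℚᵘ-/ (ℤ.+ 1) n) (toℚᵘ-/ (ℤ.+ suc n) 0) ⟩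
  ℚᵘ.mkℚᵘ (ℤ.+ 1) n ℚᵘ.* ℚᵘ.mkℚᵘ (ℤ.+ suc n) 0     ≈⟨ ℚᵘ.*≡* (cong (λ m → ℤ.+ suc m) (eq n)) ⟩
  ℚᵘ.1ℚᵘ                                       ∎)
  where
  open ℚᵘ.≃-Reasoning
  eq : ∀ n → (n ℕ.+ 0) ℕ.* 1 ≡ n ℕ.* 1 ℕ.+ 0
  eq n rewrite ℕ.+-identityʳ n | ℕ.+-identityʳ (n ℕ.* 1) = refl

1/-antimono : ∀ {m n} → m ≤ n → ℤ.+ 1 / suc n ℚ.≤ ℤ.+ 1 / suc m
1/-antimono {m} {n} m≤n = ℚ.toℚᵘ-cancel-≤ (begin
  ℚ.toℚᵘ (ℤ.+ 1 / suc n) ≃⟨ toℚᵘ-/ (ℤ.+ 1) n ⟩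
  ℚᵘ.mkℚᵘ (ℤ.+ 1) n      ≤⟨ ℚᵘ.*≤* (ℤ.+≤+ (ℕ.+-monoˡ-≤ 0 (ℕ.s≤s m≤n))) ⟩
  ℚᵘ.mkℚᵘ (ℤ.+ 1) m      ≃⟨ toℚᵘ-/ (ℤ.+ 1) m ⟨
  ℚ.toℚᵘ (ℤ.+ 1 / suc m) ∎)
  where open ℚᵘ.≤-Reasoning

p≤q⇒0≤q-p : ∀ {p q} → p ℚ.≤ q → 0ℚ ℚ.≤ q - p
p≤q⇒0≤q-p {p} {q} p≤q = subst (ℚ._≤ q - p) (ℚ.+-inverseʳ p) (ℚ.+-monoˡ-≤ (ℚ.- p) p≤q)

0≤+ : ∀ {p q} → 0ℚ ℚ.≤ p → 0ℚ ℚ.≤ q → 0ℚ ℚ.≤ p + q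
0≤+ = ℚ.+-mono-≤

0≤* : ∀ n {q} → 0ℚ ℚ.≤ q → 0ℚ ℚ.≤ # n * q
0≤* n {q} 0≤q = subst (ℚ._≤ # n * q) (ℚ.*-zeroʳ (# n)) (ℚ.*-monoˡ-≤-nonNeg (# n) 0≤q)
  where instance _ = ℚ.normalize-nonNeg n 1

-- Summation identities behind Γ and Γ₂.

-- With `p` and `q` the values at the base vertex, the left side is 2Γ(f,g) up to the factor 1/d,
-- which thus becomes a sum of products of differences.
∑-product-rule : ∀ (f g : A → ℚ) p q xs →
  (∑ xs (λ y → f y * g y - p * q) - p * ∑ xs (λ y → g y - q)) - q * ∑ xs (λ y → f y - p)
    ≡ ∑ xs (λ y → (f y - p) * (g y - q))
∑-product-rule f g p q [] = solve 2 (λ p q → (con 0ℚ :- p :* con 0ℚ) :- q :* con 0ℚ := con 0ℚ) refl p q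
∑-product-rule f g p q (x ∷ xs) = trans
  (solve 7 (λ a b p q s t u → ((a :* b :- p :* q :+ s) :- p :* (b :- q :+ t)) :- q :* (a :- p :+ u)
    := (a :- p) :* (b :- q) :+ ((s :- p :* t) :- q :* u)) refl (f x) (g x) p q _ _ _)
  (cong (_+_ ((f x - p) * (g x - q))) (∑-product-rule f g p q xs))

-- Termwise (a - p)² - 2p(a - p) = (a - 2p)² - p². This is the origin of the differences f(z) -
-- 2f(y).
∑-complete-square : ∀ (f : A → ℚ) p xs →
  ∑ xs (λ z → (f z - p) * (f z - p)) - # 2 * (p * ∑ xs (λ z → f z - p))
    ≡ ∑ xs (λ z → (f z - # 2 * p) * (f z - # 2 * p)) - ∑ xs (λ _ → p * p)
∑-complete-square f p [] = solve 1 (λ p → con 0ℚ :- con (# 2) :* (p :* con 0ℚ) := con 0ℚ) refl p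
∑-complete-square f p (x ∷ xs) = trans
  (solve 4 (λ a p s t → ((a :- p) :* (a :- p) :+ s) :- con (# 2) :* (p :* (a :- p :+ t))
    := ((a :- con (# 2) :* p) :* (a :- con (# 2) :* p) :- p :* p) :+ (s :- con (# 2) :* (p :* t))) refl (f x) p _ _)
  (trans (cong (_+_ (b * b - p * p)) (∑-complete-square f p xs))
    (solve 4 (λ a b s t → (a :- b) :+ (s :- t) := (a :+ s) :- (b :+ t)) refl (b * b) (p * p)
      (∑ xs (λ z → (f z - # 2 * p) * (f z - # 2 * p))) (∑ xs (λ _ → p * p))))
  where b = f x - # 2 * p

-- Abstracts ΔΓ(f) - 2Γ(f,Δf) at a zero of `f`: `T` stands for Γ(f), `L` for Δf, `K` for the
-- averaged squares, and `c`, `D` for the values of Γ(f) and Δf at the base vertex.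
∑-bochner : ∀ (f T L K : A → ℚ) (h c D : ℚ) xs →
  (∀ y → T y - f y * L y ≡ h * (K y - f y * f y)) →
  ∑ xs (λ y → T y - c) - ∑ xs (λ y → f y * (L y - D))
    ≡ h * (∑ xs (λ y → K y - # 2 * (f y * f y)) + ∑ xs (λ y → f y * f y)) - ∑ xs (λ _ → c) + D * ∑ xs f
∑-bochner f T L K h c D [] eq = solve 2 (λ h D → con 0ℚ := h :* con 0ℚ :- con 0ℚ :+ D :* con 0ℚ) refl h D
∑-bochner f T L K h c D (x ∷ xs) eq = trans
  (solve 7 (λ t c a l D s u → (t :- c :+ s) :- (a :* (l :- D) :+ u)
    := (t :- a :* l) :- c :+ a :* D :+ (s :- u)) refl (T x) c (f x) (L x) D _ _)
  (trans (cong₂ (λ u v → u - c + f x * D + v) (eq x) (∑-bochner f T L K h c D xs eq))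
    (solve 9 (λ h k a c D s u v w → h :* (k :- a :* a) :- c :+ a :* D :+ (h :* (s :+ u) :- v :+ D :* w)
      := h :* ((k :- con (# 2) :* (a :* a) :+ s) :+ (a :* a :+ u)) :- (c :+ v) :+ D :* (a :+ w))
      refl h (K x) (f x) c D _ _ _ _))

-- Γ₂ at a zero of f as a quadratic form.

module _ (G : Graph) where
  open Graph G renaming (sym to adj-sym)

  Γ-∑ : ∀ f g x → Γ G f g x ≡
        ½ G * (inv G (deg G x) * ∑ (nbrs x) (λ y → (f y - f x) * (g y - g x)))
  Γ-∑ f g x = cong (½ G *_) (trans
    (solve 6 (λ e p q s t u → (e :* s :- p :* (e :* t)) :- q :* (e :* u) := e :* ((s :- p :* t) :- q :* u))
      refl (inv G (deg G x)) (f x) (g x) _ _ _)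
    (cong (inv G (deg G x) *_) (∑-product-rule f g (f x) (g x) (nbrs x))))

  inv-mean : ∀ {B : Set} (xs : List B) c → 1 ≤ length xs → inv G (length xs) * ∑ xs (λ _ → c) ≡ c
  inv-mean xs@(_ ∷ ys) c _ = trans (cong (inv G (length xs) *_) (∑-const c xs))
    (trans (sym (ℚ.*-assoc (inv G (length xs)) (# (length xs)) c))
      (trans (cong (_* c) (1/n*n≡1 (length ys))) (ℚ.*-identityˡ c)))

  defect : (V → ℚ) → V → ℚ
  defect f y = ∑ (nbrs y) (λ z → (f z - # 2 * f y) * (f z - # 2 * f y))

  term : (V → ℚ) → V → ℚ
  term f y = inv G (deg G y) * defect f y - # 2 * (f y * f y)

  -- This is 4 d_x Γ₂(f)(x) when f(x) = 0, so it has the sign of Γ₂.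
  form : (V → ℚ) → V → ℚ
  form f x = ∑ (nbrs x) (term f) + # 2 * (inv G (deg G x) * (∑ (nbrs x) f * ∑ (nbrs x) f))

  module _ (deg≥1 : ∀ x → 1 ≤ deg G x) where

    Γ-Δ-identity : ∀ f y → Γ G f f y - f y * Δ G f y ≡ ½ G * (inv G (deg G y) * defect f y - f y * f y)
    Γ-Δ-identity f y = begin
      Γ G f f y - f y * (a * S)                            ≡⟨ cong (_- f y * (a * S)) (Γ-∑ f f y) ⟩
      ½ G * (a * E) - f y * (a * S)                        ≡⟨ solve 4 (λ a p s e → con (½ G) :* (a :* e) :- p :* (a :* s)
                                                                := con (½ G) :* (a :* (e :- con (# 2) :* (p :* s)))) refl a (f y) S E ⟩
      ½ G * (a * (E - # 2 * (f y * S)))                    ≡⟨ cong (λ t → ½ G * (a * t)) (∑-complete-square f (f y) (nbrs y)) ⟩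
      ½ G * (a * (defect f y - ∑ (nbrs y) (λ _ → f y * f y))) ≡⟨ solve 3 (λ a d c → con (½ G) :* (a :* (d :- c)) := con (½ G) :* (a :* d :- a :* c)) refl a (defect f y) _ ⟩
      ½ G * (a * defect f y - a * ∑ (nbrs y) (λ _ → f y * f y)) ≡⟨ cong (λ t → ½ G * (a * defect f y - t)) (inv-mean (nbrs y) (f y * f y) (deg≥1 y)) ⟩
      ½ G * (a * defect f y - f y * f y)                   ∎
      where
      open ≡-Reasoning
      a = inv G (deg G y)
      S = ∑ (nbrs y) (λ z → f z - f y)
      E = ∑ (nbrs y) (λ z → (f z - f y) * (f z - f y))

    Γ₂-form : ∀ f x → f x ≡ 0ℚ → Γ₂ G f f x ≡ ½ G * inv G (deg G x) * ½ G * form f x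
    Γ₂-form f x fx≡0 = begin
      ½ G * ((e * P - Γ G f (Δ G f) x) - Γ G (Δ G f) f x)
        ≡⟨ cong₂ (λ u v → ½ G * ((e * P - u) - v)) (trans (Γ-∑ f (Δ G f) x) (cong (λ t → ½ G * (e * t)) B≡))
                                                   (trans (Γ-∑ (Δ G f) f x) (cong (λ t → ½ G * (e * t)) B′≡)) ⟩
      ½ G * ((e * P - ½ G * (e * B)) - ½ G * (e * B))
        ≡⟨ solve 3 (λ e p b → con (½ G) :* ((e :* p :- con (½ G) :* (e :* b)) :- con (½ G) :* (e :* b))
             := con (½ G) :* e :* (p :- b)) refl e P B ⟩
      ½ G * e * (P - B)
        ≡⟨ cong (½ G * e *_) (∑-bochner f (Γ G f f) (Δ G f) (λ y → inv G (deg G y) * defect f y) (½ G)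
                               (Γ G f f x) (Δ G f x) (nbrs x) (Γ-Δ-identity f)) ⟩
      ½ G * e * (½ G * (∑ (nbrs x) (term f) + F) - ∑ (nbrs x) (λ _ → Γ G f f x) + Δ G f x * M)
        ≡⟨ cong₂ (λ u v → ½ G * e * (½ G * (∑ (nbrs x) (term f) + F) - u + v * M)) c≡ (cong (e *_) M≡) ⟩
      ½ G * e * (½ G * (∑ (nbrs x) (term f) + F) - ½ G * F + e * M * M)
        ≡⟨ solve 4 (λ e t f m → con (½ G) :* e :* (con (½ G) :* (t :+ f) :- con (½ G) :* f :+ e :* m :* m)
             := con (½ G) :* e :* con (½ G) :* (t :+ con (# 2) :* (e :* (m :* m)))) refl e (∑ (nbrs x) (term f)) F M ⟩
      ½ G * e * ½ G * form f x ∎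
      where
      open ≡-Reasoning
      e = inv G (deg G x)
      P = ∑ (nbrs x) (λ y → Γ G f f y - Γ G f f x)
      B = ∑ (nbrs x) (λ y → f y * (Δ G f y - Δ G f x))
      F = ∑ (nbrs x) (λ y → f y * f y)
      M = ∑ (nbrs x) f
      -0≡ : ∀ y → f y - f x ≡ f y
      -0≡ y = trans (cong (λ t → f y - t) fx≡0) (ℚ.+-identityʳ (f y))
      B≡ : ∑ (nbrs x) (λ y → (f y - f x) * (Δ G f y - Δ G f x)) ≡ B
      B≡ = ∑-cong (nbrs x) λ {y} _ → cong (_* (Δ G f y - Δ G f x)) (-0≡ y)
      B′≡ : ∑ (nbrs x) (λ y → (Δ G f y - Δ G f x) * (f y - f x)) ≡ B
      B′≡ = trans (∑-cong (nbrs x) λ {y} _ → ℚ.*-comm (Δ G f y - Δ G f x) (f y - f x)) B≡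
      M≡ : ∑ (nbrs x) (λ y → f y - f x) ≡ M
      M≡ = ∑-cong (nbrs x) λ {y} _ → -0≡ y
      F≡ : ∑ (nbrs x) (λ y → (f y - f x) * (f y - f x)) ≡ F
      F≡ = ∑-cong (nbrs x) λ {y} _ → cong₂ _*_ (-0≡ y) (-0≡ y)
      -- Summing the constant Γ(f)(x) over the d_x neighbours cancels the factor 1/d_x inside Γ.
      c≡ : ∑ (nbrs x) (λ _ → Γ G f f x) ≡ ½ G * F
      c≡ = begin
        ∑ (nbrs x) (λ _ → Γ G f f x)        ≡⟨ ∑-const (Γ G f f x) (nbrs x) ⟩
        # (deg G x) * Γ G f f x             ≡⟨ cong (# (deg G x) *_) (trans (Γ-∑ f f x) (cong (λ t → ½ G * (e * t)) F≡)) ⟩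
        # (deg G x) * (½ G * (e * F))       ≡⟨ solve 4 (λ d h e f → d :* (h :* (e :* f)) := h :* (e :* (d :* f))) refl (# (deg G x)) (½ G) e F ⟩
        ½ G * (e * (# (deg G x) * F))       ≡⟨ cong (λ t → ½ G * (e * t)) (sym (∑-const F (nbrs x))) ⟩
        ½ G * (e * ∑ (nbrs x) (λ _ → F))    ≡⟨ cong (½ G *_) (inv-mean (nbrs x) F (deg≥1 x)) ⟩
        ½ G * F                             ∎

    form-nonneg : CD0∞ G → ∀ f x → f x ≡ 0ℚ → 0ℚ ℚ.≤ form f x
    form-nonneg cd f x fx≡0 = ℚ.*-cancelˡ-≤-pos r
      (subst₂ ℚ._≤_ (sym (ℚ.*-zeroʳ r)) (Γ₂-form f x fx≡0) (cd f x))
      where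
      r = ½ G * inv G (deg G x) * ½ G
      inv-pos : ∀ n → 1 ≤ n → ℚ.Positive (inv G n)
      inv-pos (suc n) _ = ℚ.normalize-pos 1 (suc n)
      instance
        _ = inv-pos (deg G x) (deg≥1 x)
        _ = ℚ.pos*pos⇒pos (½ G) (inv G (deg G x))
        _ = ℚ.pos*pos⇒pos (½ G * inv G (deg G x)) (½ G)

-- Contribution of one neighbour to the form.

-- Here `a` is the reciprocal degree of a neighbour y of x, `u` the value at y and `v` the value at
-- the common neighbour of x and y. The square 4u² comes from x itself, where f is 0.
pairTerm : ℚ → ℚ → ℚ → ℚ
pairTerm a u v = a * (# 4 * (u * u) + (v - # 2 * u) * (v - # 2 * u)) - # 2 * (u * u)

singleTerm : ℚ → ℚ → ℚ
singleTerm a u = a * (# 4 * (u * u)) - # 2 * (u * u)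

-- The values are constants here, so that only reciprocal degrees remain as variables for the
-- solver.
:pairTerm : ∀ {n} → Polynomial n → ℚ → ℚ → Polynomial n
:pairTerm a u v = a :* (con (# 4) :* (con u :* con u) :+ (con v :- con (# 2) :* con u) :* (con v :- con (# 2) :* con u))
                  :- con (# 2) :* (con u :* con u)

:singleTerm : ∀ {n} → Polynomial n → ℚ → Polynomial n
:singleTerm a u = a :* (con (# 4) :* (con u :* con u)) :- con (# 2) :* (con u :* con u)

-- Decidable equality of vertices from connectedness.

module DecidableVertices (G : Graph) (connected : Connected G) where
  open Graph G renaming (sym to adj-sym)

  code : ∀ {u v} → Star (Adj G) u v → List ℕ
  code ε       = []
  code (m ◅ p) = toℕ (index m) ∷ code p

  code-injective : ∀ {u v w} (p : Star (Adj G) u v) (q : Star (Adj G) u w) → code p ≡ code q → v ≡ w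
  code-injective ε       ε       eq = refl
  code-injective (m ◅ p) (n ◅ q) eq with ∷-injective eq
  ... | i≡j , eq′ with trans (lookup-index m)
                         (trans (cong (lookup (nbrs _)) (toℕ-injective i≡j)) (sym (lookup-index n)))
  ... | refl = code-injective p q eq′

  -- A path records the positions of its steps in the neighbour lists, and these positions
  -- determine its end; so u and v are compared through the chosen paths u ⇝ u and u ⇝ v.
  abstract
    _≟_ : DecidableEquality V
    u ≟ v = map′ (code-injective (connected u u) (connected u v)) (λ { refl → refl })
                 (≡-dec ℕ._≟_ (code (connected u u)) (code (connected u v)))

-- Extension to the second sphere and reduction to the first.

module Curvature (G : Graph) (connected : Connected G) (c4-free : C4Free G)
                 (deg≥2 : MinDegree≥2 G) (cd : CD0∞ G) where
  open Graph G renaming (sym to adj-sym)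
  open DecidableVertices G connected
  open DecMembership _≟_ using (_∈?_)

  ∈⇒≢ : ∀ {x y} → y ∈ nbrs x → x ≢ y
  ∈⇒≢ {x} y∈ refl = irrefl x y∈

  -- Two different common neighbours `b` and `d` would close the 4-cycle a, b, c, d.
  common-unique : ∀ {a c b d} → a ≢ c → b ∈ nbrs a → b ∈ nbrs c → d ∈ nbrs a → d ∈ nbrs c → b ≡ d
  common-unique {a} {c} {b} {d} a≢c ab cb ad cd with b ≟ d
  ... | yes b≡d = b≡d
  ... | no b≢d = ⊥-elim (c4-free a b c d (∈⇒≢ ab) a≢c (∈⇒≢ ad) (∈⇒≢ cb ∘ sym) b≢d (∈⇒≢ cd)
                                 ab (adj-sym cb) cd (adj-sym ad))

  locate : ∀ x z → z ≡ x ⊎ z ∈ nbrs x ⊎ (z ≢ x × z ∉ nbrs x)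
  locate x z with z ≟ x | z ∈? nbrs x
  ... | yes z≡x | _      = inj₁ z≡x
  ... | no _    | yes z∈ = inj₂ (inj₁ z∈)
  ... | no z≢x  | no z∉  = inj₂ (inj₂ (z≢x , z∉))

  -- Values 2 g(y) on the second sphere annihilate every square of the defect except those
  -- at x and inside the first sphere.
  extend : V → (V → ℚ) → V → ℚ
  extend x g z with z ≟ x | z ∈? nbrs x | any? (λ y → z ∈? nbrs y) (nbrs x)
  ... | yes _ | _     | _     = 0ℚ
  ... | no _  | yes _ | _     = g z
  ... | no _  | no _  | yes p = # 2 * g (proj₁ (find p))
  -- These vertices are at distance at least 3 from `x`, and the form at `x` does not see them.
  ... | no _  | no _  | no _  = 0ℚ

  extend-centre : ∀ x g → extend x g x ≡ 0ℚ
  extend-centre x g with x ≟ x | x ∈? nbrs x | any? (λ y → x ∈? nbrs y) (nbrs x)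
  ... | yes _  | _     | _     = refl
  ... | no x≢x | _     | _     = contradiction refl x≢x

  extend-S₁ : ∀ {x y} g → y ∈ nbrs x → extend x g y ≡ g y
  extend-S₁ {x} {y} g y∈ with y ≟ x | y ∈? nbrs x | any? (λ z → y ∈? nbrs z) (nbrs x)
  ... | yes refl | _     | _ = contradiction y∈ (irrefl x)
  ... | no _     | yes _ | _ = refl
  ... | no _     | no y∉ | _ = contradiction y∈ y∉

  extend-S₂ : ∀ {x y z} g → y ∈ nbrs x → z ∈ nbrs y → z ≢ x → z ∉ nbrs x → extend x g z ≡ # 2 * g y
  extend-S₂ {x} {y} {z} g y∈ z∈ z≢x z∉ with z ≟ x | z ∈? nbrs x | any? (λ y → z ∈? nbrs y) (nbrs x)
  ... | yes z≡x | _      | _     = contradiction z≡x z≢x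
  ... | no _    | yes z∈x | _    = contradiction z∈x z∉
  -- The search may return any neighbour of `x` adjacent to `z`; both it and `y` are common
  -- neighbours of `x` and `z`, so they coincide.
  ... | no _    | no _   | yes p =
    cong (λ t → # 2 * g t) (common-unique (z≢x ∘ sym) (proj₁ (proj₂ (find p))) (adj-sym (proj₂ (proj₂ (find p)))) y∈ (adj-sym z∈))
  ... | no _    | no _   | no ¬p = contradiction (lose y∈ z∈) ¬p

  sq : ℚ → ℚ
  sq p = p * p

  defect-vanish : ∀ {x y z} g → y ∈ nbrs x → z ∈ nbrs y → z ≢ x → z ∉ nbrs x →
                  sq (extend x g z - # 2 * extend x g y) ≡ 0ℚ
  defect-vanish {x} {y} g y∈ z∈ z≢x z∉ rewrite extend-S₁ g y∈ | extend-S₂ g y∈ z∈ z≢x z∉ =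
    cong sq (ℚ.+-inverseʳ (# 2 * g y))

  -- Since `ks` is closed under adjacency within the first sphere, a neighbour y of x outside `ks`
  -- meets only zeros there, and the extension kills its squares on the second sphere. Its term
  -- vanishes, and the form lives on `ks`.
  curvature-test : ∀ x (g : V → ℚ) {ks} → Unique ks → ks ⊆ nbrs x →
    (∀ {k z} → k ∈ ks → z ∈ nbrs x → z ∈ nbrs k → z ∈ ks) → (∀ {z} → z ∉ ks → g z ≡ 0ℚ) →
    0ℚ ℚ.≤ ∑ ks (term G (extend x g)) + # 2 * (inv G (deg G x) * (∑ ks g * ∑ ks g))
  curvature-test x g {ks} uks ks⊆ closed supp =
    subst₂ (λ t m → 0ℚ ℚ.≤ t + # 2 * (inv G (deg G x) * (m * m)))
      (∑-support (term G f) uks (unique x) ks⊆ term-vanish)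
      (trans (∑-cong (nbrs x) (extend-S₁ g)) (∑-support g uks (unique x) ks⊆ (λ _ → supp)))
      (form-nonneg G (λ z → ℕ.≤-trans (ℕ.s≤s ℕ.z≤n) (deg≥2 z)) cd f x (extend-centre x g))
    where
    f = extend x g
    term-vanish : ∀ {y} → y ∈ nbrs x → y ∉ ks → term G f y ≡ 0ℚ
    term-vanish {y} y∈ y∉ks = trans
      (cong₂ (λ d u → inv G (deg G y) * d - # 2 * (u * u)) (∑-zero (nbrs y) square-vanish) fy≡0)
      (solve 1 (λ a → a :* con 0ℚ :- con (# 2) :* (con 0ℚ :* con 0ℚ) := con 0ℚ) refl (inv G (deg G y)))
      where
      fy≡0 : f y ≡ 0ℚ
      fy≡0 = trans (extend-S₁ g y∈) (supp y∉ks)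
      square-vanish : ∀ {z} → z ∈ nbrs y → sq (f z - # 2 * f y) ≡ 0ℚ
      square-vanish {z} z∈ with locate x z
      ... | inj₁ refl = cong₂ (λ u v → sq (u - # 2 * v)) (extend-centre x g) fy≡0
      ... | inj₂ (inj₂ (z≢x , z∉)) = defect-vanish g y∈ z∈ z≢x z∉
      ... | inj₂ (inj₁ z∈x) with z ∈? ks
      ...   | yes z∈ks = contradiction (closed z∈ks y∈ (adj-sym z∈)) y∉ks
      ...   | no z∉ks  = cong₂ (λ u v → sq (u - # 2 * v)) (trans (extend-S₁ g z∈x) (supp z∉ks)) fy≡0

  -- By C₄-freeness `y′` is the only common neighbour of `x` and `y`, so only the squares at `x` and
  -- `y′` survive.
  term-pair : ∀ {x y y′ u v} g → y ∈ nbrs x → y′ ∈ nbrs x → y′ ∈ nbrs y → g y ≡ u → g y′ ≡ v →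
              term G (extend x g) y ≡ pairTerm (inv G (deg G y)) u v
  term-pair {x} {y} {y′} g y∈ y′∈ yy′ refl refl = cong₂ (λ d u → inv G (deg G y) * d - # 2 * (u * u)) (trans
      (∑-support h ((∈⇒≢ y′∈ ∷ []) ∷ [] ∷ []) (unique y) (λ { (here refl) → adj-sym y∈ ; (there (here refl)) → yy′ }) vanish)
      (trans (cong₂ (λ s t → s + (t + 0ℚ))
          (cong₂ (λ a b → sq (a - # 2 * b)) (extend-centre x g) (extend-S₁ g y∈))
          (cong₂ (λ a b → sq (a - # 2 * b)) (extend-S₁ g y′∈) (extend-S₁ g y∈)))
        (solve 2 (λ u v → (con 0ℚ :- con (# 2) :* u) :* (con 0ℚ :- con (# 2) :* u) :+
            ((v :- con (# 2) :* u) :* (v :- con (# 2) :* u) :+ con 0ℚ)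
          := con (# 4) :* (u :* u) :+ (v :- con (# 2) :* u) :* (v :- con (# 2) :* u)) refl (g y) (g y′))))
      (extend-S₁ g y∈)
    where
    h : V → ℚ
    h z = sq (extend x g z - # 2 * extend x g y)
    vanish : ∀ {z} → z ∈ nbrs y → z ∉ x ∷ y′ ∷ [] → h z ≡ 0ℚ
    vanish z∈ z∉ = defect-vanish g y∈ z∈ (z∉ ∘ here) λ z∈x →
      z∉ (there (here (common-unique (∈⇒≢ y∈) z∈x z∈ y′∈ yy′)))

  term-single : ∀ {x y u} g → y ∈ nbrs x → (∀ {z} → z ∈ nbrs x → z ∉ nbrs y) → g y ≡ u →
                term G (extend x g) y ≡ singleTerm (inv G (deg G y)) u
  term-single {x} {y} g y∈ single refl = cong₂ (λ d u → inv G (deg G y) * d - # 2 * (u * u)) (trans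
      (∑-support h ([] ∷ []) (unique y) (λ { (here refl) → adj-sym y∈ })
        (λ z∈ z∉ → defect-vanish g y∈ z∈ (z∉ ∘ here) (λ z∈x → single z∈x z∈)))
      (trans (cong (_+ 0ℚ) (cong₂ (λ a b → sq (a - # 2 * b)) (extend-centre x g) (extend-S₁ g y∈)))
        (solve 1 (λ u → (con 0ℚ :- con (# 2) :* u) :* (con 0ℚ :- con (# 2) :* u) :+ con 0ℚ
          := con (# 4) :* (u :* u)) refl (g y))))
      (extend-S₁ g y∈)
    where
    h : V → ℚ
    h z = sq (extend x g z - # 2 * extend x g y)

  -- The four test functions.

  weights : List (V × ℚ) → V → ℚ
  weights []             z = 0ℚ
  weights ((k , w) ∷ ws) z with z ≟ k
  ... | yes _ = w
  ... | no _  = weights ws z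

  weights-∈ : ∀ {k w} ws → Unique (map proj₁ ws) → (k , w) ∈ ws → weights ws k ≡ w
  weights-∈ {k} ((k , w) ∷ ws) _ (here refl) with k ≟ k
  ... | yes _  = refl
  ... | no k≢k = contradiction refl k≢k
  weights-∈ {k} ((k′ , w) ∷ ws) (k# ∷ u) (there k∈) with k ≟ k′
  ... | yes refl = contradiction refl (All.lookup k# (∈-map⁺ proj₁ k∈))
  ... | no _     = weights-∈ ws u k∈

  weights-∉ : ∀ {z} ws → z ∉ map proj₁ ws → weights ws z ≡ 0ℚ
  weights-∉ []             z∉ = refl
  weights-∉ {z} ((k , w) ∷ ws) z∉ with z ≟ k
  ... | yes z≡k = contradiction (here z≡k) z∉
  ... | no _    = weights-∉ ws (z∉ ∘ there)

  -- Adding nonnegative multiples of such slacks to the form replaces each unknown reciprocal degree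
  -- by its largest admissible value and leaves a numeric constant. The degree bound is `suc k`.
  inv-slack : ∀ k {n} → suc k ≤ n → 0ℚ ℚ.≤ (ℤ.+ 1 / suc k) - inv G n
  inv-slack k (ℕ.s≤s k≤n) = p≤q⇒0≤q-p (1/-antimono k≤n)

  -- The weights 1, 1, -2 sum to zero, which removes the mean term. At the extreme degrees 2, 2, 3
  -- the form is 1/2 + 1/2 - 8/3 = -5/3.
  no-heavy-single : ∀ {x y y′ s} → y ∈ nbrs x → y′ ∈ nbrs x → y′ ∈ nbrs y → s ∈ nbrs x →
    (∀ {z} → z ∈ nbrs x → z ∉ nbrs s) → ¬ 3 ≤ deg G s
  no-heavy-single {x} {y} {y′} {s} y∈ y′∈ yy′ s∈ single 3≤ds = from-no (0ℚ ℚ.≤? (ℤ.- (ℤ.+ 5) / 3))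
    (subst (0ℚ ℚ.≤_)
      (solve 4 (λ a b c e → :pairTerm a 1ℚ 1ℚ :+ (:pairTerm b 1ℚ 1ℚ :+ (:singleTerm c (ℚ.- # 2) :+ con 0ℚ))
            :+ con (# 2) :* (e :* (con 0ℚ :* con 0ℚ))
          -- The multipliers 5, 5, 16 are the coefficients of `a`, `b`, `c` in the form, so these
          -- variables cancel. The later tests choose theirs in the same way.
          :+ (con (# 5) :* (con (ℤ.+ 1 / 2) :- a) :+ (con (# 5) :* (con (ℤ.+ 1 / 2) :- b) :+ con (# 16) :* (con (ℤ.+ 1 / 3) :- c)))
          := con (ℤ.- (ℤ.+ 5) / 3)) refl
        (inv G (deg G y)) (inv G (deg G y′)) (inv G (deg G s)) (inv G (deg G x)))
      (0≤+ (subst₂ (λ t m → 0ℚ ℚ.≤ t + # 2 * (inv G (deg G x) * (m * m)))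
          (cong₂ _+_ (term-pair g y∈ y′∈ yy′ gy gy′) (cong₂ _+_ (term-pair g y′∈ y∈ (adj-sym yy′) gy′ gy)
            (cong₂ _+_ (term-single g s∈ single gs) refl)))
          (cong₂ _+_ gy (cong₂ _+_ gy′ (cong₂ _+_ gs refl)))
          (curvature-test x g uks ks⊆ closed (weights-∉ ws)))
        (0≤+ (0≤* 5 (inv-slack 1 (deg≥2 y))) (0≤+ (0≤* 5 (inv-slack 1 (deg≥2 y′))) (0≤* 16 (inv-slack 2 3≤ds))))))
    where
    ws = (y , 1ℚ) ∷ (y′ , 1ℚ) ∷ (s , ℚ.- # 2) ∷ []
    g = weights ws
    uks : Unique (map proj₁ ws)
    uks = (∈⇒≢ yy′ ∷ (λ { refl → single y′∈ yy′ }) ∷ []) ∷ ((λ { refl → single y∈ (adj-sym yy′) }) ∷ []) ∷ [] ∷ []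
    ks⊆ : map proj₁ ws ⊆ nbrs x
    ks⊆ (here refl) = y∈
    ks⊆ (there (here refl)) = y′∈
    ks⊆ (there (there (here refl))) = s∈
    closed : ∀ {k z} → k ∈ map proj₁ ws → z ∈ nbrs x → z ∈ nbrs k → z ∈ map proj₁ ws
    closed (here refl) z∈x z∈y = there (here (common-unique (∈⇒≢ y∈) z∈x z∈y y′∈ yy′))
    closed (there (here refl)) z∈x z∈y = here (common-unique (∈⇒≢ y′∈) z∈x z∈y y∈ (adj-sym yy′))
    closed (there (there (here refl))) z∈x z∈s = contradiction z∈s (single z∈x)
    gy  = weights-∈ ws uks (here refl)
    gy′ = weights-∈ ws uks (there (here refl))
    gs  = weights-∈ ws uks (there (there (here refl)))

  -- Opposite weights again remove the mean term. At degrees 3 and 2 the contributions are -2/3 and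
  -- 0.
  no-two-singles : ∀ {s x w} → x ∈ nbrs s → w ∈ nbrs s → x ≢ w → (∀ {z} → z ∈ nbrs s → z ∉ nbrs x) →
    (∀ {z} → z ∈ nbrs s → z ∉ nbrs w) → ¬ 3 ≤ deg G x
  no-two-singles {s} {x} {w} x∈ w∈ x≢w x-single w-single 3≤dx = from-no (0ℚ ℚ.≤? (ℤ.- (ℤ.+ 2) / 3))
    (subst (0ℚ ℚ.≤_)
      (solve 3 (λ a b e → :singleTerm a 1ℚ :+ (:singleTerm b (ℚ.- 1ℚ) :+ con 0ℚ)
            :+ con (# 2) :* (e :* (con 0ℚ :* con 0ℚ))
          :+ (con (# 4) :* (con (ℤ.+ 1 / 3) :- a) :+ con (# 4) :* (con (ℤ.+ 1 / 2) :- b))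
          := con (ℤ.- (ℤ.+ 2) / 3)) refl
        (inv G (deg G x)) (inv G (deg G w)) (inv G (deg G s)))
      (0≤+ (subst₂ (λ t m → 0ℚ ℚ.≤ t + # 2 * (inv G (deg G s) * (m * m)))
          (cong₂ _+_ (term-single g x∈ x-single gx) (cong₂ _+_ (term-single g w∈ w-single gw) refl))
          (cong₂ _+_ gx (cong₂ _+_ gw refl))
          (curvature-test s g uks ks⊆ closed (weights-∉ ws)))
        (0≤+ (0≤* 4 (inv-slack 2 3≤dx)) (0≤* 4 (inv-slack 1 (deg≥2 w))))))
    where
    ws = (x , 1ℚ) ∷ (w , ℚ.- 1ℚ) ∷ []
    g = weights ws
    uks : Unique (map proj₁ ws)
    uks = (x≢w ∷ []) ∷ [] ∷ []
    ks⊆ : map proj₁ ws ⊆ nbrs s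
    ks⊆ (here refl)         = x∈
    ks⊆ (there (here refl)) = w∈
    closed : ∀ {k z} → k ∈ map proj₁ ws → z ∈ nbrs s → z ∈ nbrs k → z ∈ map proj₁ ws
    closed (here refl)         z∈s z∈x = contradiction z∈x (x-single z∈s)
    closed (there (here refl)) z∈s z∈w = contradiction z∈w (w-single z∈s)
    gx = weights-∈ ws uks (here refl)
    gw = weights-∈ ws uks (there (here refl))

  -- Weight 2 at `c` against 1 at `y` annihilates the cross square at `y`. The second triangle, with
  -- weights -1, costs 1 but lowers the sum of weights from 3 to 1. At the extreme degrees the total
  -- is 0 - 7/4 + 1/2 + 1/2 + 1/2 = -1/4.
  no-heavy-neighbour : ∀ {x y c p q} → y ∈ nbrs x → c ∈ nbrs x → c ∈ nbrs y →
    p ∈ nbrs x → q ∈ nbrs x → q ∈ nbrs p → p ≢ y → p ≢ c → 4 ≤ deg G x → ¬ 4 ≤ deg G c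
  no-heavy-neighbour {x} {y} {c} {p} {q} y∈ c∈ yc p∈ q∈ pq p≢y p≢c 4≤dx 4≤dc = from-no (0ℚ ℚ.≤? (ℤ.- (ℤ.+ 1) / 4))
    (subst (0ℚ ℚ.≤_)
      (solve 5 (λ a b c d e → :pairTerm a 1ℚ (# 2) :+ (:pairTerm b (# 2) 1ℚ :+
              (:pairTerm c (ℚ.- 1ℚ) (ℚ.- 1ℚ) :+ (:pairTerm d (ℚ.- 1ℚ) (ℚ.- 1ℚ) :+ con 0ℚ)))
            :+ con (# 2) :* (e :* (con 1ℚ :* con 1ℚ))
          :+ (con (# 4) :* (con (ℤ.+ 1 / 2) :- a) :+ (con (# 25) :* (con (ℤ.+ 1 / 4) :- b) :+
             (con (# 5) :* (con (ℤ.+ 1 / 2) :- c) :+ (con (# 5) :* (con (ℤ.+ 1 / 2) :- d) :+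
              con (# 2) :* (con (ℤ.+ 1 / 4) :- e)))))
          := con (ℤ.- (ℤ.+ 1) / 4)) refl
        (inv G (deg G y)) (inv G (deg G c)) (inv G (deg G p)) (inv G (deg G q)) (inv G (deg G x)))
      (0≤+ (subst₂ (λ t m → 0ℚ ℚ.≤ t + # 2 * (inv G (deg G x) * (m * m)))
          (cong₂ _+_ (term-pair g y∈ c∈ yc gy gc) (cong₂ _+_ (term-pair g c∈ y∈ (adj-sym yc) gc gy)
            (cong₂ _+_ (term-pair g p∈ q∈ pq gp gq) (cong₂ _+_ (term-pair g q∈ p∈ (adj-sym pq) gq gp) refl))))
          (cong₂ _+_ gy (cong₂ _+_ gc (cong₂ _+_ gp (cong₂ _+_ gq refl))))
          (curvature-test x g uks ks⊆ closed (weights-∉ ws)))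
        (0≤+ (0≤* 4 (inv-slack 1 (deg≥2 y))) (0≤+ (0≤* 25 (inv-slack 3 4≤dc))
          (0≤+ (0≤* 5 (inv-slack 1 (deg≥2 p))) (0≤+ (0≤* 5 (inv-slack 1 (deg≥2 q))) (0≤* 2 (inv-slack 3 4≤dx))))))))
    where
    ws = (y , 1ℚ) ∷ (c , # 2) ∷ (p , ℚ.- 1ℚ) ∷ (q , ℚ.- 1ℚ) ∷ []
    g = weights ws
    -- If `q` were `y`, then `p` and `c` would both be common neighbours of `x` and `y`; `c≢q` is
    -- symmetric.
    y≢q : y ≢ q
    y≢q refl = p≢c (common-unique (∈⇒≢ q∈) p∈ (adj-sym pq) c∈ yc)
    c≢q : c ≢ q
    c≢q refl = p≢y (common-unique (∈⇒≢ q∈) p∈ (adj-sym pq) y∈ (adj-sym yc))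
    uks : Unique (map proj₁ ws)
    uks = (∈⇒≢ yc ∷ (p≢y ∘ sym) ∷ y≢q ∷ []) ∷ ((p≢c ∘ sym) ∷ c≢q ∷ []) ∷ (∈⇒≢ pq ∷ []) ∷ [] ∷ []
    ks⊆ : map proj₁ ws ⊆ nbrs x
    ks⊆ (here refl)                         = y∈
    ks⊆ (there (here refl))                 = c∈
    ks⊆ (there (there (here refl)))         = p∈
    ks⊆ (there (there (there (here refl)))) = q∈
    closed : ∀ {k z} → k ∈ map proj₁ ws → z ∈ nbrs x → z ∈ nbrs k → z ∈ map proj₁ ws
    closed (here refl)                         zx zk = there (here (common-unique (∈⇒≢ y∈) zx zk c∈ yc))
    closed (there (here refl))                 zx zk = here (common-unique (∈⇒≢ c∈) zx zk y∈ (adj-sym yc))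
    closed (there (there (here refl)))         zx zk = there (there (there (here (common-unique (∈⇒≢ p∈) zx zk q∈ pq))))
    closed (there (there (there (here refl)))) zx zk = there (there (here (common-unique (∈⇒≢ q∈) zx zk p∈ (adj-sym pq))))
    gy = weights-∈ ws uks (here refl)
    gc = weights-∈ ws uks (there (here refl))
    gp = weights-∈ ws uks (there (there (here refl)))
    gq = weights-∈ ws uks (there (there (there (here refl))))

  -- The ratio 1 : 16 is nearly the minimiser of the form at a vertex of degree 2 when deg c = 16.
  triangle⇒deg<16 : ∀ {x y c} → y ∈ nbrs x → c ∈ nbrs x → c ∈ nbrs y → ¬ 16 ≤ deg G c
  triangle⇒deg<16 {x} {y} {c} y∈ c∈ yc 16≤dc = from-no (0ℚ ℚ.≤? (ℤ.- (ℤ.+ 15) / 16))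
    (subst (0ℚ ℚ.≤_)
      (solve 3 (λ a b e → :pairTerm a 1ℚ (# 16) :+ (:pairTerm b (# 16) 1ℚ :+ con 0ℚ)
            :+ con (# 2) :* (e :* (con (# 17) :* con (# 17)))
          :+ (con (# 200) :* (con (ℤ.+ 1 / 2) :- a) :+ (con (# 1985) :* (con (ℤ.+ 1 / 16) :- b) :+
              con (# 578) :* (con (ℤ.+ 1 / 2) :- e)))
          := con (ℤ.- (ℤ.+ 15) / 16)) refl
        (inv G (deg G y)) (inv G (deg G c)) (inv G (deg G x)))
      (0≤+ (subst₂ (λ t m → 0ℚ ℚ.≤ t + # 2 * (inv G (deg G x) * (m * m)))
          (cong₂ _+_ (term-pair g y∈ c∈ yc gy gc) (cong₂ _+_ (term-pair g c∈ y∈ (adj-sym yc) gc gy) refl))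
          (cong₂ _+_ gy (cong₂ _+_ gc refl))
          (curvature-test x g uks ks⊆ closed (weights-∉ ws)))
        (0≤+ (0≤* 200 (inv-slack 1 (deg≥2 y))) (0≤+ (0≤* 1985 (inv-slack 15 16≤dc))
          (0≤* 578 (inv-slack 1 (deg≥2 x)))))))
    where
    ws = (y , 1ℚ) ∷ (c , # 16) ∷ []
    g = weights ws
    uks : Unique (map proj₁ ws)
    uks = (∈⇒≢ yc ∷ []) ∷ [] ∷ []
    ks⊆ : map proj₁ ws ⊆ nbrs x
    ks⊆ (here refl)         = y∈
    ks⊆ (there (here refl)) = c∈
    closed : ∀ {k z} → k ∈ map proj₁ ws → z ∈ nbrs x → z ∈ nbrs k → z ∈ map proj₁ ws
    closed (here refl)         zx zk = there (here (common-unique (∈⇒≢ y∈) zx zk c∈ yc))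
    closed (there (here refl)) zx zk = here (common-unique (∈⇒≢ c∈) zx zk y∈ (adj-sym yc))
    gy = weights-∈ ws uks (here refl)
    gc = weights-∈ ws uks (there (here refl))

-- Transversals of a fixed-point-free involution.

-- For an involution σ, `ps` has exactly one member of each pair y, σ y that meets `xs`. It will
-- select one rim vertex per triangle of the windmill.
record Transversal (σ : A → A) (xs ps : List A) : Set where
  field
    unique      : Unique ps
    ⊆           : ps ⊆ xs
    independent : ∀ {y} → y ∈ ps → σ y ∉ ps
    covers      : ∀ {y} → y ∈ xs → y ∈ ps ⊎ σ y ∈ ps

module _ (_≟_ : DecidableEquality A) where
  open DecMembership _≟_ using (_∈?_)

  fresh : ∀ {ks xs} → Unique ks → Unique xs → length ks ℕ.< length xs → ∃ λ z → z ∈ xs × z ∉ ks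
  fresh {ks} {xs} uks uxs len with any? (λ z → ¬? (z ∈? ks)) xs
  ... | yes p = find p
  ... | no ¬p = contradiction (⊆⇒length≤ uxs uks xs⊆ks) (ℕ.<⇒≱ len)
    where
    xs⊆ks : xs ⊆ ks
    xs⊆ks {z} z∈ = decidable-stable (z ∈? ks) (λ z∉ → ¬p (lose z∈ z∉))

  -- Greedy choice: `x` is added unless it or its image is already chosen. Freeness of fixed points
  -- keeps the new list independent.
  transversal : (σ : A → A) → (∀ y → σ (σ y) ≡ y) → ∀ xs → (∀ {y} → y ∈ xs → σ y ≢ y) →
                ∃ (Transversal σ xs)
  transversal σ σσ [] free = [] , record { unique = [] ; ⊆ = λ () ; independent = λ () ; covers = λ () }
  transversal σ σσ (x ∷ xs) free with transversal σ σσ xs (free ∘ there)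
  ... | ps , t with x ∈? ps | σ x ∈? ps
  ... | yes x∈ | _ = ps , record
    { unique = t.unique ; ⊆ = there ∘ t.⊆ ; independent = t.independent
    ; covers = λ { (here refl) → inj₁ x∈ ; (there y∈) → t.covers y∈ } }
    where module t = Transversal t
  ... | no _ | yes σx∈ = ps , record
    { unique = t.unique ; ⊆ = there ∘ t.⊆ ; independent = t.independent
    ; covers = λ { (here refl) → inj₂ σx∈ ; (there y∈) → t.covers y∈ } }
    where module t = Transversal t
  ... | no x∉ | no σx∉ = x ∷ ps , record
    { unique = ¬Any⇒All¬ ps x∉ ∷ t.unique ; ⊆ = ⊆′ ; independent = indep′ ; covers = cover′ }
    where
    module t = Transversal t
    ⊆′ : x ∷ ps ⊆ x ∷ xs
    ⊆′ (here eq)  = here eq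
    ⊆′ (there y∈) = there (t.⊆ y∈)
    indep′ : ∀ {y} → y ∈ x ∷ ps → σ y ∉ x ∷ ps
    indep′ (here refl) (here eq)   = free (here refl) eq
    indep′ (here refl) (there σx∈) = σx∉ σx∈
    indep′ {y} (there y∈) (here eq) = σx∉ (subst (_∈ ps) (trans (sym (σσ y)) (cong σ eq)) y∈)
    indep′ (there y∈) (there σy∈)  = t.independent y∈ σy∈
    cover′ : ∀ {y} → y ∈ x ∷ xs → y ∈ x ∷ ps ⊎ σ y ∈ x ∷ ps
    cover′ (here eq) = inj₁ (here eq)
    cover′ (there y∈) with t.covers y∈
    ... | inj₁ y∈ps  = inj₁ (there y∈ps)
    ... | inj₂ σy∈ps = inj₂ (there σy∈ps)

lookup-injective : ∀ {xs : List A} → Unique xs → ∀ {i j} → lookup xs i ≡ lookup xs j → i ≡ j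
lookup-injective {xs = x ∷ xs} (x# ∷ u) {zero}  {zero}  eq = refl
lookup-injective {xs = x ∷ xs} (x# ∷ u) {zero}  {suc j} eq = contradiction eq (All.lookup x# (∈-lookup j))
lookup-injective {xs = x ∷ xs} (x# ∷ u) {suc i} {zero}  eq = contradiction (sym eq) (All.lookup x# (∈-lookup i))
lookup-injective {xs = x ∷ xs} (x# ∷ u) {suc i} {suc j} eq = cong suc (lookup-injective u eq)

-- Every edge lies in a triangle.

module Structure (G : Graph) (connected : Connected G) (c4-free : C4Free G)
                 (deg≥2 : MinDegree≥2 G) (cd : CD0∞ G) where
  open Graph G renaming (sym to adj-sym)
  open DecidableVertices G connected
  open Curvature G connected c4-free deg≥2 cd
  open DecMembership _≟_ using (_∈?_)

  InTriangle : V → Set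
  InTriangle x = ∃ λ y → ∃ λ y′ → y ∈ nbrs x × y′ ∈ nbrs x × y′ ∈ nbrs y

  Partner : V → V → Set
  Partner x s = ∃ λ s′ → s′ ∈ nbrs x × s′ ∈ nbrs s

  -- Suppose the edge from `x` to `s` is in no triangle. The first test function forces deg s = 2,
  -- so `s` has just one other neighbour `w`, and the edge from `s` to `w` is in no triangle either.
  -- As `x` has the three neighbours `y`, `y′`, `s`, the second test function, now centred at `s`,
  -- gives a contradiction.
  triangle⇒partner : ∀ {x s} → InTriangle x → s ∈ nbrs x → Partner x s
  triangle⇒partner {x} {s} (y , y′ , y∈ , y′∈ , yy′) s∈ with any? (_∈? nbrs s) (nbrs x)
  ... | yes p = find p
  ... | no ¬p with 3 ℕ.≤? deg G s
  ...   | yes 3≤ds = ⊥-elim (no-heavy-single y∈ y′∈ yy′ s∈ (λ z∈ zs → ¬p (lose z∈ zs)) 3≤ds)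
  ...   | no 3≰ds with fresh _≟_ {ks = x ∷ []} ([] ∷ []) (unique s) (deg≥2 s)
  ...     | w , w∈ , w∉ = ⊥-elim (no-two-singles (adj-sym s∈) w∈ (w∉ ∘ here ∘ sym) (λ zs zx → ¬p (lose zx zs)) w-single 3≤dx)
    where
    single : ∀ {z} → z ∈ nbrs x → z ∉ nbrs s
    single z∈ zs = ¬p (lose z∈ zs)
    -- A triangle on `s`, `w`, `z` would give `s` the three distinct neighbours `x`, `w`, `z`.
    w-single : ∀ {z} → z ∈ nbrs s → z ∉ nbrs w
    w-single {z} zs zw = 3≰ds (⊆⇒length≤ {ks = x ∷ w ∷ z ∷ []}
      (((w∉ ∘ here ∘ sym) ∷ (λ { refl → single (adj-sym zw) w∈ }) ∷ []) ∷ (∈⇒≢ zw ∷ []) ∷ [] ∷ []) (unique s)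
      (λ { (here refl) → adj-sym s∈ ; (there (here refl)) → w∈ ; (there (there (here refl))) → zs }))
    3≤dx : 3 ≤ deg G x
    3≤dx = ⊆⇒length≤ {ks = y ∷ y′ ∷ s ∷ []}
      ((∈⇒≢ yy′ ∷ (λ { refl → single y′∈ yy′ }) ∷ []) ∷ ((λ { refl → single y∈ (adj-sym yy′) }) ∷ []) ∷ [] ∷ []) (unique x)
      (λ { (here refl) → y∈ ; (there (here refl)) → y′∈ ; (there (there (here refl))) → s∈ })

  triangle-spreads : ∀ {x v} → InTriangle x → Star (Adj G) x v → InTriangle v
  triangle-spreads t ε = t
  triangle-spreads {x} t (s∈ ◅ path) with triangle⇒partner t s∈
  ... | s′ , s′∈x , s′∈s = triangle-spreads (x , s′ , adj-sym s∈ , s′∈s , s′∈x) path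

  -- Existence of a vertex adjacent to all others.

  -- The unit ball around `x` is closed under adjacency; by connectedness it is then the whole
  -- graph.
  Centre : V → Set
  Centre x = ∀ {y z} → y ∈ nbrs x → z ∈ nbrs y → z ≡ x ⊎ z ∈ nbrs x

  centre-covers : ∀ {x} → Centre x → ∀ {u v} → u ≡ x ⊎ u ∈ nbrs x → Star (Adj G) u v → v ≡ x ⊎ v ∈ nbrs x
  centre-covers c near        ε        = near
  centre-covers c (inj₁ refl) (m ◅ p)  = centre-covers c (inj₂ m) p
  centre-covers c (inj₂ u∈)   (m ◅ p)  = centre-covers c (c u∈ m) p

  module _ (partner : ∀ {x s} → s ∈ nbrs x → Partner x s) where

    -- Neighbours of `y` come in adjacent pairs, so a third neighbour `z` would bring a fourth, its
    -- partner, distinct from `x` and `x′` by uniqueness of common neighbours.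
    light⇒triangle : ∀ {y x x′ z} → ¬ 4 ≤ deg G y → x ∈ nbrs y → x′ ∈ nbrs y → x′ ∈ nbrs x →
                     z ∈ nbrs y → z ≡ x ⊎ z ≡ x′
    light⇒triangle {y} {x} {x′} {z} light x∈ x′∈ xx′ z∈ with z ≟ x | z ≟ x′ | partner z∈
    ... | yes z≡x | _       | _ = inj₁ z≡x
    ... | no _    | yes z≡x′ | _ = inj₂ z≡x′
    ... | no z≢x  | no z≢x′ | z′ , z′∈y , z′∈z = ⊥-elim (light (⊆⇒length≤ {ks = x ∷ x′ ∷ z ∷ z′ ∷ []}
        ((∈⇒≢ xx′ ∷ (z≢x ∘ sym) ∷ x≢z′ ∷ []) ∷ ((z≢x′ ∘ sym) ∷ x′≢z′ ∷ []) ∷ (∈⇒≢ z′∈z ∷ []) ∷ [] ∷ []) (unique y)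
        (λ { (here refl) → x∈ ; (there (here refl)) → x′∈ ; (there (there (here refl))) → z∈
           ; (there (there (there (here refl)))) → z′∈y })))
      where
      x≢z′ : x ≢ z′
      x≢z′ refl = z≢x′ (common-unique (∈⇒≢ x∈) z∈ (adj-sym z′∈z) x′∈ xx′)
      x′≢z′ : x′ ≢ z′
      x′≢z′ refl = z≢x (common-unique (∈⇒≢ x′∈) z∈ (adj-sym z′∈z) x∈ (adj-sym xx′))

    -- Opaque, since the refutation has an enormous normal form.
    abstract
      heavy⇒light-neighbour : ∀ {x y} → 4 ≤ deg G x → y ∈ nbrs x → ¬ 4 ≤ deg G y
      heavy⇒light-neighbour {x} {y} 4≤dx y∈ with partner y∈
      -- Degree at least 4 leaves a neighbour `p` of `x` outside the triangle on `x`, `y`, `y′`;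
      -- with its partner it spans the second triangle of the third test function.
      ... | y′ , y′∈ , yy′ with fresh _≟_ {ks = y′ ∷ y ∷ []} (((∈⇒≢ yy′ ∘ sym) ∷ []) ∷ [] ∷ []) (unique x) (ℕ.≤-trans (ℕ.n≤1+n 3) 4≤dx)
      ... | p , p∈ , p∉ with partner p∈
      ... | q , q∈ , pq = no-heavy-neighbour y′∈ y∈ (adj-sym yy′) p∈ q∈ pq (p∉ ∘ here) (p∉ ∘ there ∘ here) 4≤dx

    -- Each neighbour of `x` has degree below 4, so its only neighbours are `x` and its partner,
    -- itself a neighbour of `x`.
    heavy⇒centre : ∀ {x} → 4 ≤ deg G x → Centre x
    heavy⇒centre 4≤dx y∈ z∈ with partner y∈
    ... | y′ , y′∈ , yy′ with light⇒triangle (heavy⇒light-neighbour 4≤dx y∈) (adj-sym y∈) yy′ y′∈ z∈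
    ... | inj₁ z≡x  = inj₁ z≡x
    ... | inj₂ refl = inj₂ y′∈

    -- None of the three vertices has a neighbour outside the triangle, which is therefore the whole
    -- graph, and any corner serves as centre.
    light-triangle⇒centre : ∀ {a b c} → b ∈ nbrs a → c ∈ nbrs b → a ∈ nbrs c →
      ¬ 4 ≤ deg G a → ¬ 4 ≤ deg G b → ¬ 4 ≤ deg G c → Centre a
    light-triangle⇒centre ab bc ca la lb lc y∈ z∈ with light⇒triangle la ab (adj-sym ca) bc y∈
    ... | inj₁ refl with light⇒triangle lb (adj-sym ab) bc (adj-sym ca) z∈
    ...   | inj₁ z≡a  = inj₁ z≡a
    ...   | inj₂ refl = inj₂ (adj-sym ca)
    light-triangle⇒centre ab bc ca la lb lc y∈ z∈ | inj₂ refl with light⇒triangle lc ca (adj-sym bc) ab z∈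
    ...   | inj₁ z≡a  = inj₁ z≡a
    ...   | inj₂ refl = inj₂ ab

    centre-exists : HasTriangle G → ∃ Centre
    centre-exists (a , b , c , ab , bc , ca) with 4 ℕ.≤? deg G a | 4 ℕ.≤? deg G b | 4 ℕ.≤? deg G c
    ... | yes 4≤ | _      | _      = a , heavy⇒centre 4≤
    ... | no _   | yes 4≤ | _      = b , heavy⇒centre 4≤
    ... | no _   | no _   | yes 4≤ = c , heavy⇒centre 4≤
    ... | no la  | no lb  | no lc  = a , light-triangle⇒centre ab bc ca la lb lc

    -- Isomorphism with the friendship graph.

    module Windmill (x : V) (centre : Centre x) where

      -- Swaps the two rim vertices of each triangle at `x`. The identity elsewhere makes it an
      -- involution of all of `V`, and deciding membership makes it independent of membership
      -- proofs.
      mate : V → V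
      mate v with v ∈? nbrs x
      ... | yes v∈ = proj₁ (partner v∈)
      ... | no _   = v

      mate-∈ : ∀ {v} → v ∈ nbrs x → mate v ∈ nbrs x × mate v ∈ nbrs v
      mate-∈ {v} v∈ with v ∈? nbrs x
      ... | yes v∈′ = proj₂ (partner v∈′)
      ... | no v∉   = contradiction v∈ v∉

      mate-∉ : ∀ {v} → v ∉ nbrs x → mate v ≡ v
      mate-∉ {v} v∉ with v ∈? nbrs x
      ... | yes v∈ = contradiction v∈ v∉
      ... | no _   = refl

      mate-unique : ∀ {u v} → u ∈ nbrs x → v ∈ nbrs x → v ∈ nbrs u → v ≡ mate u
      mate-unique u∈ v∈ uv = common-unique (∈⇒≢ u∈) v∈ uv (proj₁ (mate-∈ u∈)) (proj₂ (mate-∈ u∈))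

      mate-involutive : ∀ v → mate (mate v) ≡ v
      mate-involutive v = case (v ∈? nbrs x) of λ where
        (yes v∈) → sym (mate-unique (proj₁ (mate-∈ v∈)) v∈ (adj-sym (proj₂ (mate-∈ v∈))))
        (no v∉)  → trans (cong mate (mate-∉ v∉)) (mate-∉ v∉)

      mate-injective : ∀ {u v} → mate u ≡ mate v → u ≡ v
      mate-injective {u} {v} eq = trans (sym (mate-involutive u)) (trans (cong mate eq) (mate-involutive v))

      abstract
        blades : ∃ (Transversal mate (nbrs x))
        blades = transversal _≟_ mate mate-involutive (nbrs x) (λ y∈ → ∈⇒≢ (proj₂ (mate-∈ y∈)) ∘ sym)

      ps : List V
      ps = proj₁ blades

      open Transversal (proj₂ blades)
        renaming (unique to ps-unique; ⊆ to ps⊆; independent to mate∉ps; covers to ps-covers)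

      k : ℕ
      k = length ps

      neighbour : ∃ λ y → y ∈ nbrs x
      neighbour with fresh _≟_ {ks = []} [] (unique x) (ℕ.≤-trans (ℕ.s≤s ℕ.z≤n) (deg≥2 x))
      ... | y , y∈ , _ = y , y∈

      1≤k : 1 ≤ k
      1≤k with ps-covers (proj₂ neighbour)
      ... | inj₁ y∈ = ∈-length y∈
      ... | inj₂ y∈ = ∈-length y∈

      deg<16 : ¬ 16 ≤ deg G x
      deg<16 with neighbour
      ... | y , y∈ with partner y∈
      -- The fourth test function is centred at the rim vertex `y`, with `x` as its heavy neighbour.
      ... | y′ , y′∈x , y′∈y = triangle⇒deg<16 y′∈y (adj-sym y∈) (adj-sym y′∈x)

      -- The chosen rim vertices and their mates are 2k distinct neighbours of `x`; with degree
      -- below 16 this gives k at most 7.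
      k+k≤deg : k ℕ.+ k ≤ deg G x
      k+k≤deg = subst (_≤ deg G x) (trans (length-++ ps) (cong (k ℕ.+_) (length-map mate ps)))
        (⊆⇒length≤ (Unique.++⁺ ps-unique (Unique.map⁺ mate-injective ps-unique) disjoint) (unique x) both⊆)
        where
        disjoint : ∀ {v} → ¬ (v ∈ ps × v ∈ map mate ps)
        disjoint (v∈ , v∈mates) with ∈-map⁻ mate v∈mates
        ... | w , w∈ , refl = mate∉ps w∈ v∈
        both⊆ : ps ++ map mate ps ⊆ nbrs x
        both⊆ v∈ with ∈-++⁻ ps v∈
        ... | inj₁ v∈ps = ps⊆ v∈ps
        ... | inj₂ v∈mates with ∈-map⁻ mate v∈mates
        ...   | w , w∈ , refl = proj₁ (mate-∈ (ps⊆ w∈))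

      k≤7 : k ≤ 7
      k≤7 with k ℕ.≤? 7
      ... | yes k≤7 = k≤7
      ... | no k≰7  = contradiction (ℕ.≤-trans (ℕ.+-mono-≤ 8≤k 8≤k) k+k≤deg) deg<16
        where 8≤k = ℕ.≰⇒> k≰7

      from : FV k → V
      from (inj₁ _)           = x
      from (inj₂ (i , false)) = lookup ps i
      from (inj₂ (i , true))  = mate (lookup ps i)

      tip∈ : ∀ i → lookup ps i ∈ nbrs x
      tip∈ i = ps⊆ (∈-lookup i)

      rim∈ : ∀ i b → from (inj₂ (i , b)) ∈ nbrs x
      rim∈ i false = tip∈ i
      rim∈ i true  = proj₁ (mate-∈ (tip∈ i))

      tip≢mate : ∀ i j → lookup ps i ≢ mate (lookup ps j)
      tip≢mate i j eq = mate∉ps (∈-lookup j) (subst (_∈ ps) eq (∈-lookup i))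

      from-injective : ∀ p q → from p ≡ from q → p ≡ q
      from-injective (inj₁ _)           (inj₁ _)           eq = refl
      from-injective (inj₁ _)           (inj₂ (i , b))     eq = contradiction eq (∈⇒≢ (rim∈ i b))
      from-injective (inj₂ (i , b))     (inj₁ _)           eq = contradiction (sym eq) (∈⇒≢ (rim∈ i b))
      from-injective (inj₂ (i , false)) (inj₂ (j , false)) eq = cong (λ i → inj₂ (i , false)) (lookup-injective ps-unique eq)
      from-injective (inj₂ (i , false)) (inj₂ (j , true))  eq = contradiction eq (tip≢mate i j)
      from-injective (inj₂ (i , true))  (inj₂ (j , false)) eq = contradiction (sym eq) (tip≢mate j i)
      from-injective (inj₂ (i , true))  (inj₂ (j , true))  eq =
        cong (λ i → inj₂ (i , true)) (lookup-injective ps-unique (mate-injective eq))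

      from-surjective : ∀ v → ∃ λ p → from p ≡ v
      from-surjective v with centre-covers centre (inj₁ refl) (connected x v)
      ... | inj₁ refl = inj₁ tt , refl
      ... | inj₂ v∈ with ps-covers v∈
      ...   | inj₁ v∈ps  = inj₂ (index v∈ps , false) , sym (lookup-index v∈ps)
      ...   | inj₂ mv∈ps = inj₂ (index mv∈ps , true) , trans (cong mate (sym (lookup-index mv∈ps))) (mate-involutive v)

      to : V → FV k
      to v = proj₁ (from-surjective v)

      from-to : ∀ v → from (to v) ≡ v
      from-to v = proj₂ (from-surjective v)

      from⇒FAdj : ∀ p q → Adj G (from p) (from q) → FAdj k p q
      from⇒FAdj (inj₁ _) (inj₁ _) adj = irrefl x adj
      from⇒FAdj (inj₁ _) (inj₂ _) adj = tt
      from⇒FAdj (inj₂ _) (inj₁ _) adj = tt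
      -- Adjacent rim vertices are mates, and the mate of a chosen vertex is never chosen, so the
      -- flags differ and the indices agree.
      from⇒FAdj (inj₂ (i , b)) (inj₂ (j , c)) adj = blade b c (mate-unique (rim∈ i b) (rim∈ j c) adj)
        where
        blade : ∀ b c → from (inj₂ (j , c)) ≡ mate (from (inj₂ (i , b))) → i ≡ j × b ≢ c
        blade false false eq = contradiction eq (tip≢mate j i)
        blade false true  eq = lookup-injective ps-unique (mate-injective (sym eq)) , λ ()
        blade true  false eq = lookup-injective ps-unique (sym (trans eq (mate-involutive _))) , λ ()
        blade true  true  eq = contradiction (trans (sym (mate-involutive _)) (sym eq)) (tip≢mate i j)

      FAdj⇒from : ∀ p q → FAdj k p q → Adj G (from p) (from q)
      FAdj⇒from (inj₁ _) (inj₂ (j , c)) _ = rim∈ j c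
      FAdj⇒from (inj₂ (i , b)) (inj₁ _) _ = adj-sym (rim∈ i b)
      FAdj⇒from (inj₂ (i , false)) (inj₂ (i , false)) (refl , b≢c) = contradiction refl b≢c
      FAdj⇒from (inj₂ (i , false)) (inj₂ (i , true))  (refl , b≢c) = proj₂ (mate-∈ (tip∈ i))
      FAdj⇒from (inj₂ (i , true))  (inj₂ (i , false)) (refl , b≢c) = adj-sym (proj₂ (mate-∈ (tip∈ i)))
      FAdj⇒from (inj₂ (i , true))  (inj₂ (i , true))  (refl , b≢c) = contradiction refl b≢c

      isomorphic : G ≅F k
      isomorphic = mk↔ₛ′ to from (λ p → from-injective _ p (from-to (from p))) from-to , λ u v →
        mk⇔ (λ adj → from⇒FAdj (to u) (to v) (subst₂ (Adj G) (sym (from-to u)) (sym (from-to v)) adj))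
            (λ fadj → subst₂ (Adj G) (from-to u) (from-to v) (FAdj⇒from (to u) (to v) fadj))

theorem4p1 : (G : Graph) → Connected G → C4Free G → MinDegree≥2 G →
    CD0∞ G → HasTriangle G →
    Σ ℕ λ k → (1 ≤ k) × (k ≤ 7) × (G ≅F k)
theorem4p1 G connected c4-free deg≥2 cd tri@(a , b , c , ab , bc , ca) = k , 1≤k , k≤7 , isomorphic
  where
  open Structure G connected c4-free deg≥2 cd
  partner : ∀ {x s} → s ∈ Graph.nbrs G x → Partner x s
  -- The given triangle at `a` spreads along a path to any vertex `x`, so every edge has a partner.
  partner {x} = triangle⇒partner (triangle-spreads (b , c , ab , Graph.sym G ca , bc) (connected a x))
  open Windmill partner (proj₁ (centre-exists partner tri)) (proj₂ (centre-exists partner tri))
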